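{- Under the structure semantics, the satisfiability problem is undecidable for $\mathsf{AQ}^k\mathsf{CTL}$ for every $k\ge1$, and for $\mathsf{EQ}^k\mathsf{CTL}$ for every $k\ge2$.
   Context: Fix a set $AP$ of atomic propositions. A Kripke structure is $S=(Q,R,\ell)$ with $Q$ countable, $R\subseteq Q\times Q$ total, $\ell:Q\to2^{AP}$. $\mathsf{CTL}$: $\varphi::=p\mid\neg\varphi\mid\varphi\vee\varphi\mid\mathbf{E}\varphi\mathbf{U}\varphi\mid\mathbf{A}\varphi\mathbf{U}\varphi\mid\mathbf{EX}\varphi\mid\mathbf{AX}\varphi$ with standard semantics; quantification $\exists p.\varphi$ (and $\forall p=\neg\exists p\neg$) has structure semantics $S,q\models_s\exists p.\varphi$ iff some $S'=(Q,R,\ell')$ with $\ell'$ agreeing with $\ell$ on $AP\setminus\{p\}$ satisfies $S',q\models_s\varphi$. For $\varphi\in\mathsf{CTL}$, $\exists p.\varphi\in\mathsf{EQ}^1\mathsf{CTL}$ and $\forall p.\varphi\in\mathsf{AQ}^1\mathsf{CTL}$; if $\varphi\in\mathsf{EQ}^k\mathsf{CTL}$ then $\exists p.\varphi\in\mathsf{EQ}^k\mathsf{CTL}$ and $\forall p.\varphi\in\mathsf{AQ}^{k+1}\mathsf{CTL}$; if $\varphi\in\mathsf{AQ}^k\mathsf{CTL}$ then $\exists p.\varphi\in\mathsf{EQ}^{k+1}\mathsf{CTL}$ and $\forall p.\varphi\in\mathsf{AQ}^k\mathsf{CTL}$. Satisfiability problem: given $\varphi$, decide whether there exist a finite Kripke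 structure $S$ and a state $q$ with $S,q\models_s\varphi$. -}

module Defs where

open import Data.Nat using (ℕ; zero; suc; _+_; _<_; _≡ᵇ_)
open import Data.Bool using (Bool; true; false; if_then_else_)
open import Data.Fin using (Fin)
open import Data.Product using (Σ; _×_; _,_)
open import Data.List using (List; []; _∷_)
open import Data.Maybe using (Maybe; just; nothing)
open import Data.Sum using (_⊎_)
open import Relation.Nullary using (¬_)
open import Relation.Binary.PropositionalEquality using (_≡_)
open import Function.Bundles using (_⇔_)

AP : Set
AP = ℕ

data Form : Set where
  var : AP → Form
  neg : Form → Form
  or  : Form → Form → Form
  EU  : Form → Form → Form
  AU  : Form → Form → Form
  EX  : Form → Form
  AX  : Form → Form
  exQ : AP → Form → Form

allQ : AP → Form → Form
allQ p φ = neg (exQ p (neg φ))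

data IsCTL : Form → Set where
  var : ∀ p → IsCTL (var p)
  neg : ∀ {φ} → IsCTL φ → IsCTL (neg φ)
  or  : ∀ {φ ψ} → IsCTL φ → IsCTL ψ → IsCTL (or φ ψ)
  EU  : ∀ {φ ψ} → IsCTL φ → IsCTL ψ → IsCTL (EU φ ψ)
  AU  : ∀ {φ ψ} → IsCTL φ → IsCTL ψ → IsCTL (AU φ ψ)
  EX  : ∀ {φ} → IsCTL φ → IsCTL (EX φ)
  AX  : ∀ {φ} → IsCTL φ → IsCTL (AX φ)

data EQ : ℕ → Form → Set
data AQ : ℕ → Form → Set

data EQ where
  base : ∀ {φ} p → IsCTL φ → EQ 1 (exQ p φ)
  eE   : ∀ {k φ} p → EQ k φ → EQ k (exQ p φ)
  eA   : ∀ {k φ} p → AQ k φ → EQ (suc k) (exQ p φ)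

data AQ where
  base : ∀ {φ} p → IsCTL φ → AQ 1 (allQ p φ)
  aE   : ∀ {k φ} p → EQ k φ → AQ (suc k) (allQ p φ)
  aA   : ∀ {k φ} p → AQ k φ → AQ k (allQ p φ)

record Kripke (n : ℕ) : Set where
  field
    R     : Fin n → Fin n → Bool
    total : ∀ q → Σ (Fin n) λ q' → R q q' ≡ true
    lab   : Fin n → AP → Bool
open Kripke public

relabel : ∀ {n} → Kripke n → AP → (Fin n → Bool) → Kripke n
relabel K p v = record
  { R = R K ; total = total K
  ; lab = λ q a → if a ≡ᵇ p then v q else lab K q a }

Path : ∀ {n} → Kripke n → Fin n → Set
Path {n} K q = Σ (ℕ → Fin n) λ π → (π 0 ≡ q) × (∀ i → R K (π i) (π (suc i)) ≡ true)

sat : ∀ {n} → Kripke n → Fin n → Form → Set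
sat K q (var p)   = lab K q p ≡ true
sat K q (neg φ)   = ¬ sat K q φ
sat K q (or φ ψ)  = sat K q φ ⊎ sat K q ψ
sat K q (EU φ ψ)  = Σ (Path K q) λ π → Σ ℕ λ i →
                      sat K (Σ.proj₁ π i) ψ × (∀ j → j < i → sat K (Σ.proj₁ π j) φ)
sat K q (AU φ ψ)  = (π : Path K q) → Σ ℕ λ i →
                      sat K (Σ.proj₁ π i) ψ × (∀ j → j < i → sat K (Σ.proj₁ π j) φ)
sat K q (EX φ)    = Σ _ λ q' → (R K q q' ≡ true) × sat K q' φ
sat K q (AX φ)    = ∀ q' → R K q q' ≡ true → sat K q' φ
sat {n} K q (exQ p φ) = Σ (Fin n → Bool) λ v → sat (relabel K p v) q φ

Satisfiable : Form → Set
Satisfiable φ = Σ ℕ λ n → Σ (Kripke n) λ K → Σ (Fin n) λ q → sat K q φ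

data Instr : Set where
  inc   : ℕ → Instr
  decjz : ℕ → ℕ → Instr

Program : Set
Program = List Instr

Regs : Set
Regs = ℕ → ℕ

fetch : Program → ℕ → Maybe Instr
fetch []      _       = nothing
fetch (i ∷ _) zero    = just i
fetch (_ ∷ P) (suc k) = fetch P k

setReg : Regs → ℕ → ℕ → Regs
setReg rs r v a = if a ≡ᵇ r then v else rs a

run : ℕ → Program → ℕ → Regs → Maybe ℕ
run zero     P pc rs = nothing
run (suc f)  P pc rs with fetch P pc
... | nothing          = just (rs 0)
... | just (inc r)     = run f P (suc pc) (setReg rs r (suc (rs r)))
... | just (decjz r l) with rs r
...   | zero  = run f P l rs
...   | suc m = run f P (suc pc) (setReg rs r m)

initRegs : ℕ → Regs
initRegs x zero    = x
initRegs x (suc _) = 0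

HaltsWith : Program → ℕ → ℕ → Set
HaltsWith M x out = Σ ℕ λ fuel → run fuel M 0 (initRegs x) ≡ just out

-- Gödel numbering of formulas (Cantor pairing)

tri : ℕ → ℕ
tri zero    = zero
tri (suc n) = suc n + tri n

pair : ℕ → ℕ → ℕ
pair a b = tri (a + b) + b

encode : Form → ℕ
encode (var p)   = pair 0 p
encode (neg φ)   = pair 1 (encode φ)
encode (or φ ψ)  = pair 2 (pair (encode φ) (encode ψ))
encode (EU φ ψ)  = pair 3 (pair (encode φ) (encode ψ))
encode (AU φ ψ)  = pair 4 (pair (encode φ) (encode ψ))
encode (EX φ)    = pair 5 (encode φ)
encode (AX φ)    = pair 6 (encode φ)
encode (exQ p φ) = pair 7 (pair p (encode φ))

DecidesSat : (Form → Set) → Program → Set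
DecidesSat F M = ∀ φ → F φ → Σ ℕ λ out → HaltsWith M (encode φ) out × (out ≡ 1 ⇔ Satisfiable φ)

SatUndecidable : (Form → Set) → Set
SatUndecidable F = ¬ Σ Program (DecidesSat F)

{-# OPTIONS --safe #-}

-- A quantifier ∀p turns CTL into a logic that can compare nodes: if p is true
-- exactly at u, then "p here implies p there" says that both nodes are u.
-- Hence the run of a counter machine D can be forced upon a Kripke structure: a
-- chain of time nodes is marked with the current location and points, for every
-- register, to a node of a descending line whose length is the register's value,
-- and ∀p relates the values at consecutive times.  "D does not halt on x with
-- output 1" thus becomes a formula, which has a finite model if D halts with
-- another output and no model if D halts with output 1.
--
-- A machine M deciding satisfiability is refuted by diagonalisation: D turns the
-- code x of the formula describing a machine into the code of the formula saying
-- that this machine does not output 1 on x, and then runs M; take for x the code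
-- of the formula describing D itself.
module Submission where

open import Defs
open import Data.Bool using (Bool; true; false; if_then_else_; _∧_)
open import Data.Bool.Properties using () renaming (_≟_ to _≟ᵇ_)
open import Data.Empty using (⊥; ⊥-elim)
open import Data.Fin using (Fin; zero; suc; toℕ; #_; fromℕ<; combine; remQuot)
open import Data.Fin.Properties
  using (toℕ<n; toℕ-fromℕ<; toℕ-injective; remQuot-combine; combine-remQuot)
open import Data.List using (List; []; _∷_; _++_; map; foldr; length)
open import Data.List.Properties using (foldr-++)
open import Data.Maybe as Maybe using (just; nothing)
open import Data.Maybe.Properties using (just-injective)
open import Data.Nat
open import Data.Nat.Properties
open import Data.Product using (Σ; _×_; _,_; proj₁; proj₂; uncurry)
open import Data.Sum using (inj₁; inj₂)
open import Data.Vec using (Vec; []; _∷_; lookup; updateAt; _[_]≔_)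
open import Function using (_∘_)
open import Function.Bundles using (Equivalence; _⇔_)
open import Relation.Nullary using (¬_; Dec; yes; no; does; contradiction)
open import Relation.Nullary.Decidable using (decidable-stable; dec-true)
open import Relation.Binary.PropositionalEquality

-- Counter machines

-- Successor registers are prescribed only pointwise, because registers read off a vector agree with
-- `setReg` only extensionally.
data Step (P : Program) (pc : ℕ) (rs : Regs) : ℕ → Regs → Set where
  inc : ∀ {r rs′} → fetch P pc ≡ just (inc r) → rs′ ≗ setReg rs r (suc (rs r)) →
        Step P pc rs (suc pc) rs′
  jz  : ∀ {r l rs′} → fetch P pc ≡ just (decjz r l) → rs r ≡ 0 → rs′ ≗ rs →
        Step P pc rs l rs′
  dec : ∀ {r l m rs′} → fetch P pc ≡ just (decjz r l) → rs r ≡ suc m → rs′ ≗ setReg rs r m →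
        Step P pc rs (suc pc) rs′

data Halts (P : Program) : ℕ → Regs → ℕ → Set where
  stop : ∀ {pc rs out} → fetch P pc ≡ nothing → rs 0 ≡ out → Halts P pc rs out
  step : ∀ {pc rs pc′ rs′ out} → Step P pc rs pc′ rs′ → Halts P pc′ rs′ out → Halts P pc rs out

setReg-cong : ∀ {rs rs′ : Regs} r {v v′} → rs ≗ rs′ → v ≡ v′ → setReg rs r v ≗ setReg rs′ r v′
setReg-cong r e refl a with a ≡ᵇ r
... | true  = refl
... | false = e a

Halts-resp-≗ : ∀ {P pc rs rs′ out} → rs ≗ rs′ → Halts P pc rs out → Halts P pc rs′ out
Halts-resp-≗ e (stop f o) = stop f (trans (sym (e 0)) o)
Halts-resp-≗ e (step (inc {r} f q) h) =
  step (inc f λ a → trans (q a) (setReg-cong r e (cong suc (e r)) a)) h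
Halts-resp-≗ e (step (jz {r} f z q) h) = step (jz f (trans (sym (e r)) z) λ a → trans (q a) (e a)) h
Halts-resp-≗ e (step (dec {r} f s q) h) =
  step (dec f (trans (sym (e r)) s) λ a → trans (q a) (setReg-cong r e refl a)) h

Halts-at : ∀ {P pc pc′ rs out} → pc ≡ pc′ → Halts P pc rs out → Halts P pc′ rs out
Halts-at refl h = h

run⇒Halts : ∀ fuel P pc rs {out} → run fuel P pc rs ≡ just out → Halts P pc rs out
run⇒Halts (suc f) P pc rs eq with fetch P pc in fe
... | nothing = stop fe (just-injective eq)
... | just (inc r) = step (inc fe λ _ → refl) (run⇒Halts f P _ _ eq)
... | just (decjz r l) with rs r in re
...   | zero  = step (jz fe re λ _ → refl) (run⇒Halts f P _ _ eq)
...   | suc m = step (dec fe re λ _ → refl) (run⇒Halts f P _ _ eq)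

-- Relocation of programs and compilation of while commands

shift : ℕ → Instr → Instr
shift o (inc r)     = inc r
shift o (decjz r l) = decjz r (o + l)

fetch-map : ∀ g P k → fetch (map g P) k ≡ Maybe.map g (fetch P k)
fetch-map g []      k       = refl
fetch-map g (i ∷ P) zero    = refl
fetch-map g (i ∷ P) (suc k) = fetch-map g P k

-- Since `fetch` agrees even where it is `nothing`, `P` reaches to the end of `D`. Hence `D` halts
-- where `P` does, as `Halts-shift` requires.
record From (D : Program) (o : ℕ) (P : Program) : Set where
  constructor from
  field fetch-from : ∀ k → fetch D (o + k) ≡ fetch P k
open From

From-head : ∀ {D o i P} → From D o (i ∷ P) → fetch D o ≡ just i
From-head {D} {o} f = trans (cong (fetch D) (sym (+-identityʳ o))) (fetch-from f 0)

From-at : ∀ {D o o′ P} → o ≡ o′ → From D o P → From D o′ P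
From-at refl f = f

From-tail : ∀ {D o i P} → From D o (i ∷ P) → From D (suc o) P
From-tail {D} {o} f = from λ k → trans (cong (fetch D) (sym (+-suc o k))) (fetch-from f (suc k))

Halts-shift : ∀ {D o P} → From D o (map (shift o) P) →
              ∀ {pc rs out} → Halts P pc rs out → Halts D (o + pc) rs out
Halts-shift {D} {o} {P} fr = go
  where
  at : ∀ {pc m} → fetch P pc ≡ m → fetch D (o + pc) ≡ Maybe.map (shift o) m
  at {pc} e = trans (fetch-from fr pc) (trans (fetch-map (shift o) P pc) (cong (Maybe.map (shift o)) e))

  go : ∀ {pc rs out} → Halts P pc rs out → Halts D (o + pc) rs out
  go (stop f e) = stop (at f) e
  go {pc} (step (inc f q) h) =
    step (inc (at f) q) (Halts-at (+-suc o pc) (go h))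
  go (step (jz f z q) h) = step (jz (at f) z q) (go h)
  go {pc} (step (dec f s q) h) =
    step (dec (at f) s q) (Halts-at (+-suc o pc) (go h))

-- while r c tests r, decrements it and then runs c; register n is never
-- written and serves as the constant zero of unconditional jumps.
data Cmd (n : ℕ) : Set where
  skip  : Cmd n
  incr  : Fin n → Cmd n
  _⨾_   : Cmd n → Cmd n → Cmd n
  while : Fin n → Cmd n → Cmd n

infixr 5 _⨾_

data _⊢_⇓_ {n} : Cmd n → Vec ℕ n → Vec ℕ n → Set where
  skip  : ∀ {v} → skip ⊢ v ⇓ v
  incr  : ∀ {v r} → incr r ⊢ v ⇓ updateAt v r suc
  _⨾_   : ∀ {c d v v′ v″} → c ⊢ v ⇓ v′ → d ⊢ v′ ⇓ v″ → (c ⨾ d) ⊢ v ⇓ v″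
  exit  : ∀ {r c v} → lookup v r ≡ 0 → while r c ⊢ v ⇓ v
  again : ∀ {r c v v′ v″ m} → lookup v r ≡ suc m → c ⊢ v [ r ]≔ m ⇓ v′ →
          while r c ⊢ v′ ⇓ v″ → while r c ⊢ v ⇓ v″

⇓-to : ∀ {n} {c : Cmd n} {v v′ v″} → v′ ≡ v″ → c ⊢ v ⇓ v′ → c ⊢ v ⇓ v″
⇓-to refl p = p

⇓-from : ∀ {n} {c : Cmd n} {u v v′} → u ≡ v → c ⊢ u ⇓ v′ → c ⊢ v ⇓ v′
⇓-from refl p = p

size : ∀ {n} → Cmd n → ℕ
size skip        = 0
size (incr r)    = 1
size (c ⨾ d)     = size c + size d
size (while r c) = 2 + size c

-- `o` is the address of the command. The code behind it is passed as `P`, so that what remains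
-- after a command is again a tail of the program in the sense of `From`.
compile : ∀ {n} → Cmd n → ℕ → Program → Program
compile skip        o P = P
compile (incr r)    o P = inc (toℕ r) ∷ P
compile (c ⨾ d)     o P = compile c o (compile d (o + size c) P)
compile {n} (while r c) o P =
  -- The exit lies behind the test, the body and the jump back.
  decjz (toℕ r) (2 + (o + size c)) ∷ compile c (suc o) (decjz n o ∷ P)

From-compile : ∀ {D n} (c : Cmd n) {o P} → From D o (compile c o P) → From D (o + size c) P
From-compile {D} skip {o} {P} f = From-at (sym (+-identityʳ o)) f
From-compile {D} (incr r) {o} {P} f = From-at (+-comm 1 o) (From-tail f)
From-compile {D} (c ⨾ d) {o} {P} f =
  From-at (+-assoc o (size c) (size d)) (From-compile d (From-compile c f))
From-compile {D} (while r c) {o} {P} f =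
  From-at (sym (trans (+-suc o _) (cong suc (+-suc o _))))
    (From-tail (From-compile c (From-tail f)))

regs : ∀ {n} → Vec ℕ n → Regs
regs []      _       = 0
regs (x ∷ v) zero    = x
regs (x ∷ v) (suc a) = regs v a

regs-lookup : ∀ {n} (v : Vec ℕ n) r → regs v (toℕ r) ≡ lookup v r
regs-lookup (x ∷ v) zero    = refl
regs-lookup (x ∷ v) (suc r) = regs-lookup v r

regs-beyond : ∀ {n} (v : Vec ℕ n) → regs v n ≡ 0
regs-beyond []      = refl
regs-beyond (x ∷ v) = regs-beyond v

regs-updateAt : ∀ {n} (v : Vec ℕ n) r g →
                regs (updateAt v r g) ≗ setReg (regs v) (toℕ r) (g (regs v (toℕ r)))
regs-updateAt (x ∷ v) zero    g zero    = refl
regs-updateAt (x ∷ v) zero    g (suc a) = refl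
regs-updateAt (x ∷ v) (suc r) g zero    = refl
regs-updateAt (x ∷ v) (suc r) g (suc a) = regs-updateAt v r g a

-- Halting is carried backwards, from behind the command to its start, by induction on the
-- evaluation.
Halts-compile : ∀ {D n} {c : Cmd n} {v v′ o P out} → From D o (compile c o P) → c ⊢ v ⇓ v′ →
                Halts D (o + size c) (regs v′) out → Halts D o (regs v) out
Halts-compile {D} {o = o} f skip h = Halts-at (+-identityʳ o) h
Halts-compile {D} {v = v} {o = o} f (incr {r = r}) h =
  step (inc (From-head f) (regs-updateAt v r suc))
       (Halts-at (+-comm o 1) h)
Halts-compile {D} {o = o} f (_⨾_ {c = c} {d = d} p q) h =
  Halts-compile f p
    (Halts-compile (From-compile c f) q
      (Halts-at (sym (+-assoc o (size c) (size d))) h))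
Halts-compile {D} {v = v} {o = o} f (exit {r = r} e) h =
  step (jz (From-head f) (trans (regs-lookup v r) e) λ _ → refl)
       (Halts-at (trans (+-suc o _) (cong suc (+-suc o _))) h)
Halts-compile {D} {v = v} {o = o} f (again {r = r} {c = c} {v′ = v′} {m = m} e p q) h =
  step (dec (From-head f) (trans (regs-lookup v r) e) (regs-updateAt v r (λ _ → m)))
    (Halts-compile (From-tail f) p
      (step (jz (From-head (From-compile c (From-tail f)))
                (regs-beyond v′) λ _ → refl)
        (Halts-compile f q h)))

-- While commands for pairing and for the code of the diagonal formula

repeat : ∀ {A : Set} → (A → A) → ℕ → A → A
repeat g zero    a = a
repeat g (suc m) a = repeat g m (g a)

repeat-suc : ∀ {A : Set} (g : A → A) m a → repeat g (suc m) a ≡ g (repeat g m a)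
repeat-suc g zero    a = refl
repeat-suc g (suc m) a = repeat-suc g m (g a)

repeat-unique : ∀ {A : Set} (g : A → A) (f : ℕ → A) → (∀ m → f (suc m) ≡ g (f m)) →
                 ∀ m → f m ≡ repeat g m (f 0)
repeat-unique g f e zero    = refl
repeat-unique g f e (suc m) =
  trans (e m) (trans (cong g (repeat-unique g f e m)) (sym (repeat-suc g m (f 0))))

while-⇓ : ∀ {n} {A : Set} {r} {c : Cmd n} (V : ℕ → A → Vec ℕ n) (g : A → A) →
          (∀ m a → lookup (V m a) r ≡ m) →
          (∀ m a → c ⊢ V (suc m) a [ r ]≔ m ⇓ V m (g a)) →
          ∀ m a → while r c ⊢ V m a ⇓ V 0 (repeat g m a)
while-⇓ V g l b zero    a = exit (l 0 a)
while-⇓ V g l b (suc m) a = again (l (suc m) a) (b m a) (while-⇓ V g l b m (g a))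

-- `#t` holds input, output and temporaries, `#n` counts loop passes, `#s` saves the input. `pairUp`
-- takes its arguments from `#a` and `#b`, collects the result in `#c` and leaves it in `#b`.
#t #n #s #a #b #c : Fin 6
#t = # 0
#n = # 1
#s = # 2
#a = # 3
#b = # 4
#c = # 5

Command : Set
Command = Cmd 6

State : Set
State = Vec ℕ 6

-- The loop on #b adds b to #a and to #c; the loop on #a then adds tri (a + b) to #c.
pairUp : Command
pairUp = while #b (incr #a ⨾ incr #c)
       ⨾ while #a (incr #c ⨾ while #a (incr #t ⨾ incr #c) ⨾ while #t (incr #a))
       ⨾ while #c (incr #b)

repeat-+ : ∀ m a → repeat suc m a ≡ m + a
repeat-+ zero    a = refl
repeat-+ (suc m) a = trans (repeat-+ m (suc a)) (+-suc m a)

move : ∀ {n} {r} {c : Cmd n} (V : ℕ → ℕ → Vec ℕ n) →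
       (∀ m a → lookup (V m a) r ≡ m) →
       (∀ m a → c ⊢ V (suc m) a [ r ]≔ m ⇓ V m (suc a)) →
       ∀ m a → while r c ⊢ V m a ⇓ V 0 (m + a)
move {r = r} {c} V l b m a =
  ⇓-to (cong (V 0) (repeat-+ m a)) (while-⇓ V suc l b m a)

move₂ : ∀ {n} {r} {c : Cmd n} (V : ℕ → ℕ → ℕ → Vec ℕ n) →
        (∀ m a b → lookup (V m a b) r ≡ m) →
        (∀ m a b → c ⊢ V (suc m) a b [ r ]≔ m ⇓ V m (suc a) (suc b)) →
        ∀ m a b → while r c ⊢ V m a b ⇓ V 0 (m + a) (m + b)
move₂ {r = r} {c} V l s zero    a b = exit (l 0 a b)
move₂ {r = r} {c} V l s (suc m) a b =
  again (l (suc m) a b) (s m a b)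
    (⇓-to (cong₂ (V 0) (+-suc m a) (+-suc m b)) (move₂ V l s m (suc a) (suc b)))

-- Each pass adds the old value of `#a` to `#c`: one for the decrement of the test, the rest while
-- `#a` is emptied into `#t`, from which it is then refilled.
triangle : ∀ {n s} a c →
  while #a (incr #c ⨾ while #a (incr #t ⨾ incr #c) ⨾ while #t (incr #a))
    ⊢ 0 ∷ n ∷ s ∷ a ∷ 0 ∷ c ∷ [] ⇓ (0 ∷ n ∷ s ∷ 0 ∷ 0 ∷ tri a + c ∷ [])
triangle zero c = exit refl
triangle {n} {s} (suc a) c =
  again refl
    (incr ⨾ move₂ (λ m t k → t ∷ n ∷ s ∷ m ∷ 0 ∷ k ∷ []) (λ _ _ _ → refl) (λ _ _ _ → incr ⨾ incr)
              a 0 (suc c)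
          ⨾ move (λ m k → m ∷ n ∷ s ∷ k ∷ 0 ∷ a + suc c ∷ []) (λ _ _ → refl) (λ _ _ → incr)
              (a + 0) 0)
    (⇓-from (cong (λ k → 0 ∷ n ∷ s ∷ k ∷ 0 ∷ a + suc c ∷ [])
              (sym (trans (+-identityʳ _) (+-identityʳ _))))
      (⇓-to (cong (λ k → 0 ∷ n ∷ s ∷ 0 ∷ 0 ∷ k ∷ []) eq) (triangle a (a + suc c))))
  where
  open ≡-Reasoning
  eq : tri a + (a + suc c) ≡ suc (a + tri a) + c
  eq = begin
    tri a + (a + suc c)  ≡⟨ +-assoc (tri a) a (suc c) ⟨
    (tri a + a) + suc c  ≡⟨ +-suc (tri a + a) c ⟩
    suc (tri a + a + c)  ≡⟨ cong (λ k → suc (k + c)) (+-comm (tri a) a) ⟩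
    suc (a + tri a) + c  ∎

pairUp-⇓ : ∀ {n s} a b →
  pairUp ⊢ 0 ∷ n ∷ s ∷ a ∷ b ∷ 0 ∷ [] ⇓ (0 ∷ n ∷ s ∷ 0 ∷ pair a b ∷ 0 ∷ [])
pairUp-⇓ {n} {s} a b =
  ⇓-to (cong (λ k → 0 ∷ n ∷ s ∷ 0 ∷ k ∷ 0 ∷ []) eq)
    ( move₂ (λ m i k → 0 ∷ n ∷ s ∷ i ∷ m ∷ k ∷ []) (λ _ _ _ → refl) (λ _ _ _ → incr ⨾ incr) b a 0
    ⨾ triangle (b + a) (b + 0)
    ⨾ move (λ m k → 0 ∷ n ∷ s ∷ 0 ∷ k ∷ m ∷ []) (λ _ _ → refl) (λ _ _ → incr) _ 0)
  where
  eq : tri (b + a) + (b + 0) + 0 ≡ pair a b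
  eq = trans (+-identityʳ _) (cong₂ (λ i j → tri i + j) (+-comm b a) (+-identityʳ b))

add : Fin 6 → ℕ → Command
add r zero    = skip
add r (suc k) = incr r ⨾ add r k

add-⇓ : ∀ {r} (V : ℕ → State) → (∀ a → updateAt (V a) r suc ≡ V (suc a)) →
        ∀ k a → add r k ⊢ V a ⇓ V (k + a)
add-⇓ V l zero    a = skip
add-⇓ {r} V l (suc k) a =
  ⇓-to (l a) incr ⨾ ⇓-to (cong V (+-suc k a)) (add-⇓ V l k (suc a))

pairs : List ℕ → ℕ → ℕ
pairs cs y = foldr pair y cs

pairAll : List ℕ → Command
pairAll []       = skip
pairAll (c ∷ cs) = pairAll cs ⨾ add #a c ⨾ pairUp

pairAll-⇓ : ∀ {n s} cs y →
  pairAll cs ⊢ 0 ∷ n ∷ s ∷ 0 ∷ y ∷ 0 ∷ [] ⇓ (0 ∷ n ∷ s ∷ 0 ∷ pairs cs y ∷ 0 ∷ [])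
pairAll-⇓ []       y = skip
pairAll-⇓ {n} {s} (c ∷ cs) y =
  pairAll-⇓ cs y
  ⨾ ⇓-to (cong (λ k → 0 ∷ n ∷ s ∷ k ∷ pairs cs y ∷ 0 ∷ []) (+-identityʳ c))
      (add-⇓ (λ a → 0 ∷ n ∷ s ∷ a ∷ pairs cs y ∷ 0 ∷ []) (λ _ → refl) c 0)
  ⨾ pairUp-⇓ c (pairs cs y)

initRegs-regs : ∀ x → initRegs x ≗ regs (x ∷ 0 ∷ 0 ∷ 0 ∷ 0 ∷ 0 ∷ [])
initRegs-regs x zero = refl
initRegs-regs x (suc zero) = refl
initRegs-regs x (suc (suc zero)) = refl
initRegs-regs x (suc (suc (suc zero))) = refl
initRegs-regs x (suc (suc (suc (suc zero)))) = refl
initRegs-regs x (suc (suc (suc (suc (suc zero))))) = refl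
initRegs-regs x (suc (suc (suc (suc (suc (suc _)))))) = refl

module _ (base : ℕ) (cs₁ cs₂ cs₃ : List ℕ) where

  -- For suitable constants this is the code of the diagonal formula, where `x` is the code of its
  -- first disjunct. The iteration builds the numeral of `x`, `cs₂` the input condition around it,
  -- `cs₃` the disjunction and everything outside.
  selfCode : ℕ → ℕ
  selfCode x = pairs cs₃ (pair x (pairs cs₂ (repeat (pairs cs₁) x base)))

  compute : Command
  -- The input is needed twice: as the number of passes building the numeral and as a code to be
  -- paired.
  compute = while #t (incr #n ⨾ incr #s)
          ⨾ add #b base
          ⨾ while #n (pairAll cs₁)
          ⨾ pairAll cs₂
          ⨾ while #s (incr #a)
          ⨾ pairUp
          ⨾ pairAll cs₃
          ⨾ while #b (incr #t)

  compute-⇓ : ∀ x → compute ⊢ x ∷ 0 ∷ 0 ∷ 0 ∷ 0 ∷ 0 ∷ [] ⇓ (selfCode x ∷ 0 ∷ 0 ∷ 0 ∷ 0 ∷ 0 ∷ [])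
  compute-⇓ x =
      ⇓-to (cong (λ k → 0 ∷ k ∷ k ∷ 0 ∷ 0 ∷ 0 ∷ []) (+-identityʳ x))
        (move₂ (λ m i k → m ∷ i ∷ k ∷ 0 ∷ 0 ∷ 0 ∷ []) (λ _ _ _ → refl) (λ _ _ _ → incr ⨾ incr) x 0 0)
    ⨾ ⇓-to (cong (λ k → 0 ∷ x ∷ x ∷ 0 ∷ k ∷ 0 ∷ []) (+-identityʳ base))
        (add-⇓ (λ b → 0 ∷ x ∷ x ∷ 0 ∷ b ∷ 0 ∷ []) (λ _ → refl) base 0)
    ⨾ while-⇓ (λ m b → 0 ∷ m ∷ x ∷ 0 ∷ b ∷ 0 ∷ []) (pairs cs₁) (λ _ _ → refl)
        (λ _ b → pairAll-⇓ cs₁ b) x base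
    ⨾ pairAll-⇓ cs₂ y₁
    ⨾ ⇓-to (cong (λ k → 0 ∷ 0 ∷ 0 ∷ k ∷ y₂ ∷ 0 ∷ []) (+-identityʳ x))
        (move (λ m k → 0 ∷ 0 ∷ m ∷ k ∷ y₂ ∷ 0 ∷ []) (λ _ _ → refl) (λ _ _ → incr) x 0)
    ⨾ pairUp-⇓ x y₂
    ⨾ pairAll-⇓ cs₃ (pair x y₂)
    ⨾ ⇓-to (cong (λ k → k ∷ 0 ∷ 0 ∷ 0 ∷ 0 ∷ 0 ∷ []) (+-identityʳ (selfCode x)))
        (move (λ m k → k ∷ 0 ∷ 0 ∷ 0 ∷ m ∷ 0 ∷ []) (λ _ _ → refl) (λ _ _ → incr) (selfCode x) 0)
    where
    y₁ = repeat (pairs cs₁) x base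
    y₂ = pairs cs₂ y₁

  abstract
    -- Opaque, so that the code of the formula describing this program is never unfolded.
    precompose : Program → Program
    precompose P = compile compute 0 (map (shift (size compute)) P)

    Halts-precompose : ∀ {P} x {out} → Halts P 0 (initRegs (selfCode x)) out →
                       Halts (precompose P) 0 (initRegs x) out
    Halts-precompose {P} x h =
      Halts-resp-≗ (λ a → sym (initRegs-regs x a))
        (Halts-compile {D} {o = 0} (from λ _ → refl) (compute-⇓ x)
          (Halts-resp-≗ (initRegs-regs (selfCode x))
            (Halts-at (+-identityʳ (size compute))
              (Halts-shift (From-compile {D} compute {0} (from λ _ → refl)) h))))
      where
      D : Program
      D = precompose P

-- Formulas describing runs

infixr 6 _∧ᶠ_
infixr 5 _⇒ᶠ_

-- Satisfaction interprets `or` by a sum type. Under negations, the connectives can be introduced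
-- without deciding which side holds.
_∧ᶠ_ _⇒ᶠ_ : Form → Form → Form
φ ∧ᶠ ψ = neg (or (neg φ) (neg ψ))
φ ⇒ᶠ ψ = neg (neg (or (neg φ) ψ))

-- Atom 0 is the universally quantified proposition, atom 1 is bound by the
-- dummy quantifiers, and the atoms from 2 on are the marks.
data Mark : Set where
  time end : Mark
  reg loc  : ℕ → Mark

double : ℕ → ℕ
double zero    = zero
double (suc n) = suc (suc (double n))

index : Mark → ℕ
index time    = 0
index end     = 1
index (reg r) = 2 + double r
index (loc l) = 3 + double l

markOf : ℕ → Mark
markOf 0 = time
markOf 1 = end
markOf 2 = reg 0
markOf 3 = loc 0
markOf (suc (suc (suc (suc n)))) with markOf (2 + n)
... | time  = time
... | end   = end
... | reg r = reg (suc r)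
... | loc l = loc (suc l)

markOf-index : ∀ m → markOf (index m) ≡ m
markOf-index time = refl
markOf-index end  = refl
markOf-index (reg zero) = refl
markOf-index (reg (suc r)) rewrite markOf-index (reg r) = refl
markOf-index (loc zero) = refl
markOf-index (loc (suc l)) rewrite markOf-index (loc l) = refl

mark : Mark → Form
mark m = var (2 + index m)

prop tt : Form
prop = var 0
tt   = neg (neg (or prop (neg prop)))

AG : Form → Form
AG φ = neg (EU tt (neg φ))

conj : ℕ → (ℕ → Form) → Form
conj zero    f = tt
conj (suc n) f = conj n f ∧ᶠ f n

-- A node represents the number m if the descending line starting at it
-- reaches its end after exactly m steps.
num : ℕ → Form
num zero    = mark end
num (suc m) = neg (or (mark end) (neg (AX (num m))))

inputF : ℕ → Form
inputF x = AX (mark (reg 0) ⇒ᶠ num x)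

data Move : Set where
  keep up down : Move

-- Counters change by pointing elsewhere on the line: the new node is the old one, or all its
-- successors are the old one, or it is a successor of the old one.
pre post : Move → Form
pre keep  = prop
pre up    = prop
pre down  = EX prop
post keep = prop
post up   = neg (mark end) ∧ᶠ AX prop
post down = prop

-- Letting prop hold exactly at one node turns this into the equation
-- between the old and the new value of register r.
moveF : Move → ℕ → Form
moveF m r = EX (mark (reg r) ∧ᶠ pre m) ⇒ᶠ AX (mark time ⇒ᶠ AX (mark (reg r) ⇒ᶠ post m))

only : Move → ℕ → ℕ → Move
only m r s = if s ≡ᵇ r then m else keep

register : Instr → ℕ
register (inc r)     = r
register (decjz r l) = r

-- The extra 1 makes register 0 tracked in every program.
width : Program → ℕ
width []      = 1
width (i ∷ P) = suc (register i) ⊔ width P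

module Simulation (D : Program) where

  -- All locations beyond the program are identified with its length.
  locF : ℕ → Form
  locF l = mark (loc (l ⊓ length D))

  stepF : ℕ → (ℕ → Move) → Form
  stepF l m = AX (mark time ⇒ᶠ locF l) ∧ᶠ conj (width D) (λ s → moveF (m s) s)

  isZeroF : ℕ → Form
  isZeroF r = AX (mark (reg r) ⇒ᶠ mark end)

  instrF : ℕ → Instr → Form
  instrF l (inc r)      = stepF (suc l) (only up r)
  instrF l (decjz r l′) =
    (isZeroF r ⇒ᶠ stepF l′ (λ _ → keep)) ∧ᶠ (neg (isZeroF r) ⇒ᶠ stepF (suc l) (only down r))

  programF : ℕ → Program → Form
  programF o []      = tt
  programF o (i ∷ P) = (mark (loc o) ⇒ᶠ instrF o i) ∧ᶠ programF (suc o) P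

  aliveF haltF nodeF initF : Form
  aliveF = mark time ⇒ᶠ (EX (mark time) ∧ᶠ conj (width D) (λ s → EX (mark (reg s))))
  haltF  = mark (loc (length D)) ⇒ᶠ AX (mark (reg 0) ⇒ᶠ neg (num 1))
  nodeF  = aliveF ∧ᶠ haltF ∧ᶠ programF 0 D
  -- Register 0 is exempt from the zero test, since `inputF` prescribes its value.
  initF  = mark time ∧ᶠ locF 0 ∧ᶠ conj (width D) (λ s → if s ≡ᵇ 0 then tt else isZeroF s) ∧ᶠ AG nodeF

  -- Only the second conjunct depends on `x`. So `x` may be chosen as the code of `neg initF`, which
  -- occurs in this very formula.
  bodyF : ℕ → Form
  bodyF x = initF ∧ᶠ inputF x

-- A record, because `sat` reduces and the formula could not be inferred from its unfolding.
record _▸_⊨_ {n} (K : Kripke n) (q : Fin n) (φ : Form) : Set where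
  constructor ⟪_⟫
  field holds : sat K q φ
open _▸_⊨_

-- Introduction and elimination rules for satisfaction

module _ {n} {K : Kripke n} where

  ∧-intro : ∀ {q φ ψ} → K ▸ q ⊨ φ → K ▸ q ⊨ ψ → K ▸ q ⊨ (φ ∧ᶠ ψ)
  ∧-intro ⟪ a ⟫ ⟪ b ⟫ = ⟪ (λ { (inj₁ ¬a) → ¬a a ; (inj₂ ¬b) → ¬b b }) ⟫

  -- A conjunction encoded by negations yields its parts only on the way to a contradiction; hence
  -- the continuation into `⊥`, here and in the rules below.
  ∧-elim : ∀ {q φ ψ} → K ▸ q ⊨ (φ ∧ᶠ ψ) → (K ▸ q ⊨ φ → K ▸ q ⊨ ψ → ⊥) → ⊥
  ∧-elim ⟪ h ⟫ k = h (inj₁ λ a → h (inj₂ λ b → k ⟪ a ⟫ ⟪ b ⟫))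

  ⇒-intro : ∀ {q φ ψ} → (K ▸ q ⊨ φ → K ▸ q ⊨ ψ) → K ▸ q ⊨ (φ ⇒ᶠ ψ)
  ⇒-intro f = ⟪ (λ k → k (inj₁ λ a → k (inj₂ (holds (f ⟪ a ⟫))))) ⟫

  ⇒-elim : ∀ {q φ ψ} → K ▸ q ⊨ (φ ⇒ᶠ ψ) → K ▸ q ⊨ φ → (K ▸ q ⊨ ψ → ⊥) → ⊥
  ⇒-elim ⟪ h ⟫ ⟪ a ⟫ k = h λ { (inj₁ ¬a) → ¬a a ; (inj₂ b) → k ⟪ b ⟫ }

  neg-intro : ∀ {q φ} → ¬ (K ▸ q ⊨ φ) → K ▸ q ⊨ neg φ
  neg-intro k = ⟪ (λ a → k ⟪ a ⟫) ⟫

  neg-elim : ∀ {q φ} → K ▸ q ⊨ neg φ → ¬ (K ▸ q ⊨ φ)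
  neg-elim ⟪ k ⟫ ⟪ a ⟫ = k a

  EX-intro : ∀ {q q′ φ} → R K q q′ ≡ true → K ▸ q′ ⊨ φ → K ▸ q ⊨ EX φ
  EX-intro e ⟪ a ⟫ = ⟪ _ , e , a ⟫

  EX-elim : ∀ {q φ} → K ▸ q ⊨ EX φ → Σ (Fin n) λ q′ → R K q q′ ≡ true × K ▸ q′ ⊨ φ
  EX-elim ⟪ q′ , e , a ⟫ = q′ , e , ⟪ a ⟫

  AX-intro : ∀ {q φ} → (∀ q′ → R K q q′ ≡ true → K ▸ q′ ⊨ φ) → K ▸ q ⊨ AX φ
  AX-intro f = ⟪ (λ q′ e → holds (f q′ e)) ⟫

  AX-elim : ∀ {q q′ φ} → K ▸ q ⊨ AX φ → R K q q′ ≡ true → K ▸ q′ ⊨ φ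
  AX-elim {q′ = q′} ⟪ f ⟫ e = ⟪ f q′ e ⟫

  tt-intro : ∀ {q} → K ▸ q ⊨ tt
  tt-intro {q} = ⟪ (λ k → k (inj₂ λ a → k (inj₁ a))) ⟫

  conj-intro : ∀ {q} m {f} → (∀ r → r < m → K ▸ q ⊨ f r) → K ▸ q ⊨ conj m f
  conj-intro zero    h = tt-intro
  conj-intro (suc m) h = ∧-intro (conj-intro m λ r r<m → h r (m<n⇒m<1+n r<m)) (h m ≤-refl)

  conj-elim : ∀ {q m f r} → K ▸ q ⊨ conj m f → r < m → (K ▸ q ⊨ f r → ⊥) → ⊥
  conj-elim {m = suc m} h (s≤s r≤m) k with m≤n⇒m<n∨m≡n r≤m
  ... | inj₁ r<m  = ∧-elim h λ a _ → conj-elim a r<m k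
  ... | inj₂ refl = ∧-elim h λ _ b → k b

  AG-intro : ∀ {q φ} → (∀ q′ → K ▸ q′ ⊨ φ) → K ▸ q ⊨ AG φ
  AG-intro f = ⟪ (λ { (π , i , ¬a , _) → ¬a (holds (f (proj₁ π i))) }) ⟫

  -- `AG` speaks of infinite paths, so one starting at `q` has to be supplied; totality of the
  -- relation gives it.
  AG-now : ∀ {q φ} → K ▸ q ⊨ AG φ → (K ▸ q ⊨ φ → ⊥) → ⊥
  AG-now {q} ⟪ h ⟫ k = h ((walk , refl , λ i → proj₂ (total K (walk i))) , 0 , (λ a → k ⟪ a ⟫) , λ _ ())
    where
    walk : ℕ → Fin n
    walk zero    = q
    walk (suc i) = proj₁ (total K (walk i))

  -- A path from `q′` to a violation becomes one from `q` by putting `q` in front.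
  AG-next : ∀ {q q′ φ} → K ▸ q ⊨ AG φ → R K q q′ ≡ true → K ▸ q′ ⊨ AG φ
  AG-next {q} ⟪ h ⟫ e = ⟪ (λ { ((π , π₀ , πR) , i , a , _) →
    h ( ( (λ { zero → q ; (suc j) → π j }) , refl
        , λ { zero → subst (λ u → R K q u ≡ true) (sym π₀) e ; (suc j) → πR j })
      , suc i , a , λ _ _ → holds tt-intro) }) ⟫

-- Every model of the formula follows the run

fetch-< : ∀ P {k i} → fetch P k ≡ just i → k < length P
fetch-< (_ ∷ P) {zero}  e = s≤s z≤n
fetch-< (_ ∷ P) {suc k} e = s≤s (fetch-< P e)

fetch-≥ : ∀ P {k} → fetch P k ≡ nothing → length P ≤ k
fetch-≥ []                e = z≤n
fetch-≥ (_ ∷ P) {suc k} e = s≤s (fetch-≥ P e)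

register-< : ∀ P {k i} → fetch P k ≡ just i → register i < width P
register-< (i ∷ P) {zero}  refl = m≤m⊔n (suc (register i)) (width P)
register-< (i ∷ P) {suc k} e    = ≤-trans (register-< P e) (m≤n⊔m (suc (register i)) _)

width-positive : ∀ P → 0 < width P
width-positive []      = s≤s z≤n
width-positive (i ∷ P) = ≤-trans (width-positive P) (m≤n⊔m (suc (register i)) (width P))

data Moves : Move → ℕ → ℕ → Set where
  keep : ∀ {a} → Moves keep a a
  up   : ∀ {a} → Moves up a (suc a)
  down : ∀ {a} → Moves down (suc a) a

only-moves : ∀ {m r v} {rs rs′ : Regs} → Moves m (rs r) v → rs′ ≗ setReg rs r v →
             ∀ s → Moves (only m r s) (rs s) (rs′ s)
only-moves {r = r} {rs = rs} mv e s with s ≡ᵇ r in eq | e s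
... | false | e′ rewrite e′ = keep
... | true  | e′ rewrite e′ | ≡ᵇ⇒≡ s r (subst Data.Bool.T (sym eq) _) = mv

keep-moves : ∀ {rs rs′ : Regs} → rs′ ≗ rs → ∀ s → Moves keep (rs s) (rs′ s)
keep-moves e s rewrite e s = keep

_⟨_⟩ : ∀ {n} → Kripke n → (Fin n → AP → Bool) → Kripke n
K ⟨ L ⟩ = record { R = R K ; total = total K ; lab = L }

SameMarks : ∀ {n} (L L′ : Fin n → AP → Bool) → Set
SameMarks L L′ = ∀ q a → L q (2 + a) ≡ L′ q (2 + a)

-- Atom 1 is left open, since the dummy quantifiers may change it.
record Variant {n} (K : Kripke n) (v : Fin n → Bool) (L : Fin n → AP → Bool) : Set where
  field
    marks : SameMarks L (lab K)
    props : ∀ q → L q 0 ≡ v q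

-- Always K t φ: up to double negation, φ holds at t whatever the value of
-- atom 0 and for some value of atom 1.
Always : ∀ {n} (K : Kripke n) (t : Fin n) (φ : Form) → Set
Always K t φ = ∀ v → (∀ L → Variant K v L → (K ⟨ L ⟩) ▸ t ⊨ φ → ⊥) → ⊥

module Soundness (D : Program) {n} (K : Kripke n) where
  open Simulation D

  Has : Fin n → Mark → Set
  Has q m = lab K q (2 + index m) ≡ true

  Has-stable : ∀ {q m} → ¬ ¬ Has q m → Has q m
  Has-stable {q} {m} = decidable-stable (lab K q (2 + index m) ≟ᵇ true)

  open Variant

  mark-intro : ∀ {v L} → Variant K v L → ∀ {q m} → Has q m → (K ⟨ L ⟩) ▸ q ⊨ mark m
  mark-intro V {q} {m} e = ⟪ trans (marks V q (index m)) e ⟫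

  mark-elim : ∀ {v L} → Variant K v L → ∀ {q m} → (K ⟨ L ⟩) ▸ q ⊨ mark m → Has q m
  mark-elim V {q} {m} ⟪ e ⟫ = trans (sym (marks V q (index m))) e

  -- The meaning of `num` in terms of the marks of `K`, hence the same for all variants.
  Represents : Fin n → ℕ → Set
  Represents u zero    = Has u end
  Represents u (suc m) = ¬ Has u end × (∀ w → R K u w ≡ true → Represents w m)

  -- Only Boolean labels, negations and universal quantifiers occur, and these are stable. This is
  -- how facts about values leave the double negations.
  Represents-stable : ∀ m {u} → ¬ ¬ Represents u m → Represents u m
  Represents-stable zero    {u} h = Has-stable {u} {end} h
  Represents-stable (suc m) h =
    (λ e → h λ r → proj₁ r e) , λ w e → Represents-stable m λ k → h λ r → k (proj₂ r w e)

  num-elim : ∀ {v L} → Variant K v L → ∀ m {u} → (K ⟨ L ⟩) ▸ u ⊨ num m → Represents u m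
  num-elim V zero    h     = mark-elim V {m = end} h
  num-elim V (suc m) ⟪ h ⟫ =
    (λ e → h (inj₁ (holds (mark-intro V {m = end} e)))) ,
    λ w e → Represents-stable m λ k → h (inj₂ λ a → k (num-elim V m ⟪ a w e ⟫))

  num-intro : ∀ {v L} → Variant K v L → ∀ m {u} → Represents u m → (K ⟨ L ⟩) ▸ u ⊨ num m
  num-intro V zero    h       = mark-intro V {m = end} h
  num-intro V (suc m) (p , r) =
    ⟪ (λ { (inj₁ e) → p (mark-elim V {m = end} ⟪ e ⟫)
         ; (inj₂ k) → k λ w e → holds (num-intro V m (r w e)) }) ⟫

  -- A moment may point to several nodes for one register, so `values` speaks of all of them; that
  -- there is at least one follows from `aliveF`.
  record Config (t : Fin n) (pc : ℕ) (rs : Regs) : Set where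
    field
      rules    : Always K t (AG nodeF)
      isTime   : Has t time
      location : Has t (loc (pc ⊓ length D))
      values   : ∀ {r u} → r < width D → R K t u ≡ true → Has u (reg r) → Represents u (rs r)
  open Config

  node : ∀ {t pc rs} → Config t pc rs → Always K t nodeF
  node c v k = rules c v λ L V h → AG-now h λ a → k L V a

  alive : ∀ {t pc rs} → Config t pc rs →
          Always K t (EX (mark time) ∧ᶠ conj (width D) (λ s → EX (mark (reg s))))
  alive c v k = node c v λ L V h → ∧-elim h λ a _ → ⇒-elim a (mark-intro V {m = time} (isTime c)) (k L V)

  some-value : ∀ {t pc rs r} → Config t pc rs → r < width D →
               (∀ u → R K t u ≡ true → Has u (reg r) → ⊥) → ⊥
  some-value {r = r} c r< k = alive c (λ _ → true) λ L V h → ∧-elim h λ _ a → conj-elim a r< λ b →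
    let (u , e , m) = EX-elim b in k u e (mark-elim V {m = reg r} m)

  some-successor : ∀ {t pc rs} → Config t pc rs →
                   (∀ t′ → R K t t′ ≡ true → Has t′ time → ⊥) → ⊥
  some-successor c k = alive c (λ _ → true) λ L V h → ∧-elim h λ a _ →
    let (t′ , e , m) = EX-elim a in k t′ e (mark-elim V {m = time} m)

  at : Fin n → Fin n → Bool
  at u q = does (u Data.Fin.≟ q)

  at-intro : ∀ {u L} → Variant K (at u) L → (K ⟨ L ⟩) ▸ u ⊨ prop
  at-intro {u} V = ⟪ trans (props V u) (dec-true (u Data.Fin.≟ u) refl) ⟫

  at-elim : ∀ {u q L} → Variant K (at u) L → (K ⟨ L ⟩) ▸ q ⊨ prop → u ≡ q
  at-elim {u} {q} V ⟪ e ⟫ with u Data.Fin.≟ q | trans (sym (props V q)) e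
  ... | yes p | _ = p

  -- Atom 0 is made true at one node `x` only: at the old node `u`, or for `down` at a successor of
  -- `u`. Then `post` identifies `u′`, or for `up` each successor of `u′`, with `x`.
  move-value : ∀ {t t′ r m u u′ a b} → Moves m a b → Always K t (moveF m r) →
               R K t t′ ≡ true → Has t′ time →
               R K t u ≡ true → Has u (reg r) → Represents u a →
               R K t′ u′ ≡ true → Has u′ (reg r) → ¬ ¬ Represents u′ b
  move-value {t} {t′} {r} {m} {u} {u′} mv al tt′ time′ tu ru rep t′u′ ru′ k = go mv rep
    where
    finish : ∀ x → (∀ {L} → Variant K (at x) L → (K ⟨ L ⟩) ▸ u ⊨ pre m) →
             (∀ {L} → Variant K (at x) L → (K ⟨ L ⟩) ▸ u′ ⊨ post m → ⊥) → ⊥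
    finish x p q = al (at x) λ L V h →
      ⇒-elim h (EX-intro tu (∧-intro (mark-intro V {m = reg r} ru) (p V))) λ h₁ →
      ⇒-elim (AX-elim h₁ tt′) (mark-intro V {m = time} time′) λ h₂ →
      ⇒-elim (AX-elim h₂ t′u′) (mark-intro V {m = reg r} ru′) λ h₃ → q V h₃

    go : Moves m _ _ → Represents u _ → ⊥
    go keep rep = finish u at-intro λ V h → k (subst (λ w → Represents w _) (at-elim V h) rep)
    go (up {a}) rep = finish u at-intro λ V h → ∧-elim h λ p q →
      k ((λ e → neg-elim p (mark-intro V {m = end} e)) ,
         λ w e → subst (λ w → Represents w a) (at-elim V (AX-elim q e)) rep)
    go (down {a}) rep = let (w , e) = total K u in
      finish w (λ V → EX-intro e (at-intro V)) λ V h →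
        k (subst (λ w → Represents w a) (at-elim V h) (proj₂ rep w e))

  advance : ∀ {t pc rs l rs′ m} → Config t pc rs → Always K t (stepF l m) →
            (∀ s → Moves (m s) (rs s) (rs′ s)) → (∀ t′ → Config t′ l rs′ → ⊥) → ⊥
  advance {t} {l = l} c al mv k = some-successor c λ t′ e time′ → k t′ record
    { rules    = λ v k → rules c v λ L V h → k L V (AG-next h e)
    ; isTime   = time′
    ; location = Has-stable {m = loc (l ⊓ length D)} λ k → al (λ _ → true) λ L V h → ∧-elim h λ a _ →
        ⇒-elim (AX-elim a e) (mark-intro V {m = time} time′) λ b → k (mark-elim V {m = loc (l ⊓ length D)} b)
    -- By stability, some node for the old value may be assumed, and `move-value` compares the given
    -- new node with it.
    ; values   = λ {r} r< e′ ru′ → Represents-stable _ λ k → some-value c r< λ u tu ru →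
        move-value (mv r) (λ v k → al v λ L V h → ∧-elim h λ _ b → conj-elim b r< (k L V))
          e time′ tu ru (values c r< tu ru) e′ ru′ k
    }

  programF-elim : ∀ {L q} P o {k i} → fetch P k ≡ just i → (K ⟨ L ⟩) ▸ q ⊨ programF o P →
                  ((K ⟨ L ⟩) ▸ q ⊨ (mark (loc (o + k)) ⇒ᶠ instrF (o + k) i) → ⊥) → ⊥
  programF-elim (i ∷ P) o {zero}  refl h k rewrite +-identityʳ o = ∧-elim h λ a _ → k a
  programF-elim (i ∷ P) o {suc j} e    h k rewrite +-suc o j     =
    ∧-elim h λ _ b → programF-elim P (suc o) e b k

  current : ∀ {t pc rs i} → Config t pc rs → fetch D pc ≡ just i → Always K t (instrF pc i)
  current {pc = pc} c f v k = node c v λ L V h → ∧-elim h λ _ a → ∧-elim a λ _ b →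
    programF-elim D 0 f b λ d → ⇒-elim d
      -- A location with an instruction lies inside the program, so the cap at `length D` leaves it
      -- unchanged.
      (subst (λ l → (K ⟨ L ⟩) ▸ _ ⊨ mark (loc l)) (m≤n⇒m⊓n≡m (<⇒≤ (fetch-< D f)))
        (mark-intro V {m = loc (pc ⊓ length D)} (location c))) (k L V)

  -- Induction on the halting run: each step leads to a successor marked `time`, and at the end
  -- `haltF` forbids the value 1 in register 0.
  simulate : ∀ {t pc rs} → Halts D pc rs 1 → Config t pc rs → ⊥
  simulate {t} {pc} {rs} (stop f e) c = node c (λ _ → true) λ L V h →
    ∧-elim h λ _ a → ∧-elim a λ b _ → ⇒-elim b
      (subst (λ l → (K ⟨ L ⟩) ▸ t ⊨ mark (loc l)) (m≥n⇒m⊓n≡n (fetch-≥ D f))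
        (mark-intro V {m = loc (pc ⊓ length D)} (location c))) λ d →
    some-value c (width-positive D) λ u tu ru →
    ⇒-elim (AX-elim d tu) (mark-intro V {m = reg 0} ru) λ g →
    neg-elim g (num-intro V 1 (subst (Represents u) e (values c (width-positive D) tu ru)))
  simulate (step (inc f q) h) c =
    advance c (current c f) (only-moves up q) λ t′ → simulate h
  simulate {t} {pc} {rs} (step (jz {r} {l} f z q) h) c = advance c
    (λ v k → current c f v λ L V a → ∧-elim a λ b _ → ⇒-elim b
      (AX-intro λ u e → ⇒-intro λ ru → mark-intro V {m = end}
        (subst (Represents u) z (values c (register-< D f) e (mark-elim V {m = reg r} ru)))) (k L V))
    (keep-moves q) λ t′ → simulate h
  simulate {t} {pc} {rs} (step (dec {r} {l} {m} f s q) h) c = advance c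
    (λ v k → current c f v λ L V a → ∧-elim a λ _ b → ⇒-elim b
      -- Without a node for the value `isZeroF` would hold vacuously, so one is fetched first; it
      -- represents a successor and is no end.
      (neg-intro λ z → some-value c (register-< D f) λ u tu ru →
        ⇒-elim (AX-elim z tu) (mark-intro V {m = reg r} ru) λ e →
        proj₁ (subst (Represents u) s (values c (register-< D f) tu ru)) (mark-elim V {m = end} e))
      (k L V))
    (only-moves (subst (λ k → Moves down k m) (sym s) down) q) λ t′ → simulate h

  initial : ∀ {t x} → Always K t (bodyF x) → (Config t 0 (initRegs x) → ⊥) → ⊥
  initial {t} {x} al k = k record
    { rules    = λ v k → whole v λ L V a b c d i → k L V d
    ; isTime   = Has-stable {m = time} λ k → whole (λ _ → true) λ L V a b c d i →
        k (mark-elim V {m = time} a)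
    ; location = Has-stable {m = loc 0} λ k → whole (λ _ → true) λ L V a b c d i →
        k (mark-elim V {m = loc 0} b)
    ; values   = λ {r} r< tu ru → Represents-stable (initRegs x r) λ k →
        whole (λ _ → true) λ L V a b c d i → val r V c i r< tu ru k
    }
    where
    whole : ∀ v → (∀ L → Variant K v L → (K ⟨ L ⟩) ▸ t ⊨ mark time → (K ⟨ L ⟩) ▸ t ⊨ locF 0 →
                   (K ⟨ L ⟩) ▸ t ⊨ conj (width D) (λ s → if s ≡ᵇ 0 then tt else isZeroF s) →
                   (K ⟨ L ⟩) ▸ t ⊨ AG nodeF → (K ⟨ L ⟩) ▸ t ⊨ inputF x → ⊥) → ⊥
    whole v k = al v λ L V h → ∧-elim h λ a i → ∧-elim a λ a b → ∧-elim b λ b c → ∧-elim c λ c d →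
      k L V a b c d i

    val : ∀ {v L} r {u} → Variant K v L →
          (K ⟨ L ⟩) ▸ t ⊨ conj (width D) (λ s → if s ≡ᵇ 0 then tt else isZeroF s) →
          (K ⟨ L ⟩) ▸ t ⊨ inputF x →
          r < width D → R K t u ≡ true → Has u (reg r) → ¬ ¬ Represents u (initRegs x r)
    val zero    V c i r< tu ru k =
      ⇒-elim (AX-elim i tu) (mark-intro V {m = reg 0} ru) λ h → k (num-elim V x h)
    val (suc r) V c i r< tu ru k = conj-elim c r< λ z →
      ⇒-elim (AX-elim z tu) (mark-intro V {m = reg (suc r)} ru) λ h → k (mark-elim V {m = end} h)

-- Finite models of halting runs

≡ᵇ-sound : ∀ a b → (a ≡ᵇ b) ≡ true → a ≡ b
≡ᵇ-sound a b e = ≡ᵇ⇒≡ a b (subst Data.Bool.T (sym e) _)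

≡ᵇ-refl : ∀ a → (a ≡ᵇ a) ≡ true
≡ᵇ-refl zero    = refl
≡ᵇ-refl (suc a) = ≡ᵇ-refl a

module _ {P : Program} where

  steps : ∀ {pc rs out} → Halts P pc rs out → ℕ
  steps (stop _ _) = 0
  steps (step _ h) = suc (steps h)

  -- After the run the last configuration is repeated: the model has moments beyond its end, and the
  -- rules are verified at every node.
  locAt : ∀ {pc rs out} → Halts P pc rs out → ℕ → ℕ
  locAt {pc = pc} h zero = pc
  locAt {pc = pc} (stop _ _) (suc i) = pc
  locAt           (step _ h) (suc i) = locAt h i

  regsAt : ∀ {pc rs out} → Halts P pc rs out → ℕ → Regs
  regsAt {rs = rs} h zero = rs
  regsAt {rs = rs} (stop _ _) (suc i) = rs
  regsAt           (step _ h) (suc i) = regsAt h i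

  data Status {pc rs out} (h : Halts P pc rs out) (i : ℕ) : Set where
    halted  : fetch P (locAt h i) ≡ nothing → regsAt h i 0 ≡ out → Status h i
    running : i < steps h → Step P (locAt h i) (regsAt h i) (locAt h (suc i)) (regsAt h (suc i)) →
              Status h i

  status : ∀ {pc rs out} (h : Halts P pc rs out) i → Status h i
  status (stop f e) zero    = halted f e
  status (stop f e) (suc i) = halted f e
  status (step s h) zero    = running (s≤s z≤n) s
  status (step s h) (suc i) with status h i
  ... | halted f e    = halted f e
  ... | running i< s′ = running (s≤s i<) s′

  setReg-≤ : ∀ {rs : Regs} {b v} r → (∀ a → rs a ≤ b) → v ≤ suc b → ∀ a → setReg rs r v a ≤ suc b
  setReg-≤ r le v≤ a with a ≡ᵇ r
  ... | true  = v≤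
  ... | false = m≤n⇒m≤1+n (le a)

  Step-≤ : ∀ {pc rs pc′ rs′ b} → Step P pc rs pc′ rs′ → (∀ a → rs a ≤ b) → ∀ a → rs′ a ≤ suc b
  Step-≤ (inc {r} f q)   le a rewrite q a = setReg-≤ r le (s≤s (le r)) a
  Step-≤ (jz f z q)      le a rewrite q a = m≤n⇒m≤1+n (le a)
  Step-≤ {rs = rs} {b = b} (dec {r} {m = m} f s q) le a rewrite q a =
    setReg-≤ r le (m≤n⇒m≤1+n (≤-trans (n≤1+n m) (subst (_≤ b) s (le r)))) a

  regsAt-≤ : ∀ {pc rs out b} (h : Halts P pc rs out) → (∀ a → rs a ≤ b) →
             ∀ i a → regsAt h i a ≤ b + steps h
  regsAt-≤ h le zero a = ≤-trans (le a) (m≤m+n _ _)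
  regsAt-≤ (stop f e) le (suc i) a = ≤-trans (le a) (m≤m+n _ _)
  regsAt-≤ {b = b} (step s h) le (suc i) a =
    subst (regsAt h i a ≤_) (sym (+-suc b (steps h))) (regsAt-≤ h (Step-≤ s le) i a)

  Step-fetch : ∀ {pc rs pc′ rs′} → Step P pc rs pc′ rs′ → Σ Instr λ i → fetch P pc ≡ just i
  Step-fetch (inc f _)   = _ , f
  Step-fetch (jz f _ _)  = _ , f
  Step-fetch (dec f _ _) = _ , f

initRegs-≤ : ∀ x a → initRegs x a ≤ x
initRegs-≤ x zero    = ≤-refl
initRegs-≤ x (suc a) = z≤n

data Node : Set where
  moment : ℕ → Node
  value  : ℕ → ℕ → Node

module Model (D : Program) {x out} (h : Halts D 0 (initRegs x) out) where
  open Simulation D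

  -- The nodes form a grid, with one row for the moments and one per register. The same bound serves
  -- all rows, as no step raises a register by more than one.
  bound order : ℕ
  bound = x + steps h
  order = suc (width D) * suc bound

  toNode : Fin (suc (width D)) × Fin (suc bound) → Node
  toNode (zero  , i) = moment (toℕ i)
  toNode (suc r , v) = value (toℕ r) (toℕ v)

  toNode-injective : ∀ a b → toNode a ≡ toNode b → a ≡ b
  toNode-injective (zero , i)  (zero , j)  e = cong (zero ,_) (toℕ-injective (moment-inj e))
    where
    moment-inj : ∀ {i j} → moment i ≡ moment j → i ≡ j
    moment-inj refl = refl
  toNode-injective (suc r , v) (suc s , w) e =
    cong₂ (λ r v → suc r , v) (toℕ-injective (proj₁ (value-inj e))) (toℕ-injective (proj₂ (value-inj e)))
    where
    value-inj : ∀ {r v s w} → value r v ≡ value s w → r ≡ s × v ≡ w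
    value-inj refl = refl , refl

  Valid : Node → Set
  Valid (moment i)  = i ≤ bound
  Valid (value r v) = r < width D × v ≤ bound

  abstract
    view : Fin order → Node
    view q = toNode (remQuot {suc (width D)} (suc bound) q)

    view-injective : ∀ {q q′} → view q ≡ view q′ → q ≡ q′
    view-injective {q} {q′} e = begin
      q                                                  ≡⟨ combine-remQuot {suc (width D)} (suc bound) q ⟨
      uncurry combine (remQuot {suc (width D)} _ q)      ≡⟨ cong (uncurry combine) (toNode-injective _ _ e) ⟩
      uncurry combine (remQuot {suc (width D)} _ q′)     ≡⟨ combine-remQuot {suc (width D)} (suc bound) q′ ⟩
      q′                                                 ∎
      where open ≡-Reasoning

    view-valid : ∀ q → Valid (view q)
    view-valid q with remQuot {suc (width D)} (suc bound) q
    ... | zero  , i = ≤-pred (toℕ<n i)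
    ... | suc r , v = toℕ<n r , ≤-pred (toℕ<n v)

    view-surjective : ∀ N → Valid N → Σ (Fin order) λ q → view q ≡ N
    view-surjective (moment i) i≤ =
      combine {suc (width D)} zero (fromℕ< (s≤s i≤)) ,
      trans (cong toNode (remQuot-combine {suc (width D)} zero (fromℕ< (s≤s i≤))))
            (cong moment (toℕ-fromℕ< _))
    view-surjective (value r v) (r< , v≤) =
      combine (suc (fromℕ< r<)) (fromℕ< (s≤s v≤)) ,
      trans (cong toNode (remQuot-combine (suc (fromℕ< r<)) (fromℕ< (s≤s v≤))))
            (cong₂ value (toℕ-fromℕ< _) (toℕ-fromℕ< _))

  -- Totality is achieved by loops: zero is its own predecessor, and from the last moment of the run
  -- on, time leads to that moment. Each register has its own line, on which every value has exactly
  -- one node.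
  edge : Node → Node → Bool
  edge (moment i)  (moment j)  = j ≡ᵇ suc i ⊓ steps h
  edge (moment i)  (value r v) = v ≡ᵇ regsAt h i r
  edge (value r v) (value s w) = (s ≡ᵇ r) ∧ (w ≡ᵇ pred v)
  edge (value r v) (moment i)  = false

  marked : Node → Mark → Bool
  marked (moment i)  time    = true
  marked (moment i)  (loc l) = l ≡ᵇ locAt h i ⊓ length D
  marked (value r v) end     = v ≡ᵇ 0
  marked (value r v) (reg s) = s ≡ᵇ r
  marked _           _       = false

  successor : Node → Node
  successor (moment i)  = moment (suc i ⊓ steps h)
  successor (value r v) = value r (pred v)

  successor-valid : ∀ N → Valid N → Valid (successor N)
  successor-valid (moment i)  _         = ≤-trans (m⊓n≤n (suc i) (steps h)) (m≤n+m (steps h) x)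
  successor-valid (value r v) (r< , v≤) = r< , ≤-trans (pred[n]≤n {v}) v≤

  edge-successor : ∀ N → edge N (successor N) ≡ true
  edge-successor (moment i)  = ≡ᵇ-refl (suc i ⊓ steps h)
  edge-successor (value r v) rewrite ≡ᵇ-refl r = ≡ᵇ-refl (pred v)

  model : Kripke order
  R     model q q′ = edge (view q) (view q′)
  total model q    =
    let (q′ , e) = view-surjective (successor (view q)) (successor-valid (view q) (view-valid q))
    in q′ , subst (λ N → edge (view q) N ≡ true) (sym e) (edge-successor (view q))
  lab   model q (suc (suc a)) = marked (view q) (markOf a)
  lab   model q _             = false

  -- Only the marks are fixed: the rules must hold whatever the quantifiers choose for atoms 0 and
  -- 1.
  module _ {L} (L≈ : SameMarks L (lab model)) where

    private K = model ⟨ L ⟩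

    marked⇒⊨ : ∀ {q} m → marked (view q) m ≡ true → K ▸ q ⊨ mark m
    marked⇒⊨ {q} m e =
      ⟪ trans (L≈ q (index m)) (trans (cong (marked (view q)) (markOf-index m)) e) ⟫

    ⊨⇒marked : ∀ {q} m → K ▸ q ⊨ mark m → marked (view q) m ≡ true
    ⊨⇒marked {q} m ⟪ e ⟫ =
      trans (sym (cong (marked (view q)) (markOf-index m))) (trans (sym (L≈ q (index m))) e)

    time-view : ∀ {q} → K ▸ q ⊨ mark time → Σ ℕ λ i → view q ≡ moment i
    time-view {q} a with view q | ⊨⇒marked {q} time a
    ... | moment i | _ = i , refl

    loc-view : ∀ {q l} → K ▸ q ⊨ mark (loc l) →
               Σ ℕ λ i → view q ≡ moment i × l ≡ locAt h i ⊓ length D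
    loc-view {q} {l} a with view q | ⊨⇒marked {q} (loc l) a
    ... | moment i | e = i , refl , ≡ᵇ-sound l _ e

    next-moment : ∀ {q q′ i} → view q ≡ moment i → R K q q′ ≡ true → K ▸ q′ ⊨ mark time →
                  view q′ ≡ moment (suc i ⊓ steps h)
    next-moment {q} {q′} v e a with view q | view q′ | ⊨⇒marked {q′} time a
    next-moment refl e a | moment i | moment j | _ = cong moment (≡ᵇ-sound j _ e)

    value-of : ∀ {q q′ i r} → view q ≡ moment i → R K q q′ ≡ true → K ▸ q′ ⊨ mark (reg r) →
               view q′ ≡ value r (regsAt h i r)
    value-of {q} {q′} {r = r} v e a with view q | view q′ | ⊨⇒marked {q′} (reg r) a
    value-of {r = r} refl e a | moment i | value s w | m with refl ← ≡ᵇ-sound r s m =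
      cong (value r) (≡ᵇ-sound w _ e)

    next-value : ∀ {q q′ r v} → view q ≡ value r v → R K q q′ ≡ true → view q′ ≡ value r (pred v)
    next-value {q} {q′} u e with view q | view q′
    next-value refl e | value r v | value s w with s ≡ᵇ r in s≡r
    ... | true = cong₂ value (≡ᵇ-sound s r s≡r) (≡ᵇ-sound w _ e)

    end-intro : ∀ {q r} → view q ≡ value r 0 → K ▸ q ⊨ mark end
    end-intro e = marked⇒⊨ end (cong (λ N → marked N end) e)

    end-elim : ∀ {q r v} → view q ≡ value r (suc v) → ¬ (K ▸ q ⊨ mark end)
    end-elim e a with () ← trans (sym (⊨⇒marked end a)) (cong (λ N → marked N end) e)

    num-intro : ∀ {q r} v → view q ≡ value r v → K ▸ q ⊨ num v
    num-intro zero    e = end-intro e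
    num-intro (suc v) e =
      ⟪ (λ { (inj₁ a) → end-elim e ⟪ a ⟫
           ; (inj₂ k) → k λ w e′ → holds (num-intro v (next-value e e′)) }) ⟫

    num-1-elim : ∀ {q r} v → view q ≡ value r v → K ▸ q ⊨ num 1 → v ≡ 1
    num-1-elim zero e ⟪ a ⟫ = ⊥-elim (a (inj₁ (holds (end-intro e))))
    num-1-elim (suc zero) e a = refl
    num-1-elim {q} (suc (suc v)) e ⟪ a ⟫ =
      let (w , e′) = total K q in
      ⊥-elim (a (inj₂ λ f → end-elim (next-value e e′) ⟪ f w e′ ⟫))

    -- Since a value has only one node per register, the node where `pre` finds atom 0 true is the
    -- node where `post` asks for it, whatever the truth set of atom 0 is.
    moveF-intro : ∀ {q i m r} → view q ≡ moment i → i < steps h →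
                  Moves m (regsAt h i r) (regsAt h (suc i) r) → K ▸ q ⊨ moveF m r
    moveF-intro {q} {i} {m} {r} e i< mv = ⇒-intro λ ex → AX-intro λ t′ e₁ → ⇒-intro λ a₁ →
      AX-intro λ u′ e₂ → ⇒-intro λ a₂ →
      let (u , e₃ , a) = EX-elim ex in
      go mv (λ k → ∧-elim a λ b p → k u (value-of e e₃ b) p)
        (value-of (trans (next-moment e e₁ a₁) (cong moment (m≤n⇒m⊓n≡m i<))) e₂ a₂)
      where
      prop-stable : ∀ {q} → ¬ ¬ (K ▸ q ⊨ prop) → K ▸ q ⊨ prop
      prop-stable {q} k = ⟪ decidable-stable (L q 0 ≟ᵇ true) (λ n → k λ a → n (holds a)) ⟫

      same : ∀ {u u′} {φ} → view u ≡ view u′ → K ▸ u ⊨ φ → K ▸ u′ ⊨ φ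
      same e a = subst (λ q → K ▸ q ⊨ _) (view-injective e) a

      go : ∀ {a b u′} → Moves m a b →
           ((∀ u → view u ≡ value r a → K ▸ u ⊨ pre m → ⊥) → ⊥) →
           view u′ ≡ value r b → K ▸ u′ ⊨ post m
      go keep p e′ = prop-stable λ k → p λ u e a → k (same (trans e (sym e′)) a)
      go up   p e′ = ∧-intro (neg-intro (end-elim e′)) (AX-intro λ w e₁ → prop-stable λ k →
        p λ u e a → k (same (trans e (sym (next-value e′ e₁))) a))
      go down p e′ = prop-stable λ k → p λ u e a →
        let (w , e₁ , b) = EX-elim a in k (same (trans (next-value e e₁) (sym e′)) b)

    stepF-intro : ∀ {q i m} → view q ≡ moment i → i < steps h →
                  (∀ s → Moves (m s) (regsAt h i s) (regsAt h (suc i) s)) →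
                  K ▸ q ⊨ stepF (locAt h (suc i)) m
    stepF-intro {q} {i} e i< mv = ∧-intro
      (AX-intro λ t′ e₁ → ⇒-intro λ a → marked⇒⊨ (loc l)
        (trans (cong (λ N → marked N (loc l)) (trans (next-moment e e₁ a) (cong moment (m≤n⇒m⊓n≡m i<))))
               (≡ᵇ-refl l)))
      (conj-intro (width D) λ s _ → moveF-intro e i< (mv s))
      where l = locAt h (suc i) ⊓ length D

    value-node : ∀ {q i r} → view q ≡ moment i → r < width D →
                 Σ (Fin order) λ u → R K q u ≡ true × view u ≡ value r (regsAt h i r)
    value-node {q} {i} {r} e r< =
      let (u , e′) = view-surjective (value r (regsAt h i r)) (r< , regsAt-≤ h (initRegs-≤ x) i r)
      in u , trans (cong₂ edge e e′) (≡ᵇ-refl (regsAt h i r)) , e′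

    reg-intro : ∀ {u r v} → view u ≡ value r v → K ▸ u ⊨ mark (reg r)
    reg-intro {r = r} e = marked⇒⊨ (reg r) (trans (cong (λ N → marked N (reg r)) e) (≡ᵇ-refl r))

    aliveF-intro : ∀ q → K ▸ q ⊨ aliveF
    aliveF-intro q = ⇒-intro λ a → let (i , e) = time-view a in
      ∧-intro (next i e) (conj-intro (width D) λ r r< →
        let (u , e₁ , e₂) = value-node e r< in EX-intro e₁ (reg-intro e₂))
      where
      next : ∀ i → view q ≡ moment i → K ▸ q ⊨ EX (mark time)
      next i e = let (q′ , e₁) = view-surjective _ (successor-valid (view q) (view-valid q)) in
        EX-intro (subst (λ N → edge (view q) N ≡ true) (sym e₁) (edge-successor (view q)))
          (marked⇒⊨ time (trans (cong (λ N → marked N time) e₁) (cong (λ N → marked (successor N) time) e)))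

    haltF-intro : out ≢ 1 → ∀ q → K ▸ q ⊨ haltF
    haltF-intro out≢1 q = ⇒-intro λ a → let (i , e , l) = loc-view a in
      AX-intro λ u e₁ → ⇒-intro λ b → neg-intro λ c → go i l (status h i) (num-1-elim _ (value-of e e₁ b) c)
      where
      go : ∀ i → length D ≡ locAt h i ⊓ length D → Status h i → regsAt h i 0 ≡ 1 → ⊥
      go i l (halted _ e)  e′ = out≢1 (trans (sym e) e′)
      -- The mark puts the location at or beyond `length D`, where no instruction could be executed.
      go i l (running _ s) e′ = <-irrefl refl
        (≤-<-trans (subst (_≤ locAt h i) (sym l) (m⊓n≤m _ _))
                   (fetch-< D (proj₂ (Step-fetch s))))

    instrF-intro : ∀ {q i ins} → view q ≡ moment i → i < steps h → fetch D (locAt h i) ≡ just ins →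
                   Step D (locAt h i) (regsAt h i) (locAt h (suc i)) (regsAt h (suc i)) →
                   K ▸ q ⊨ instrF (locAt h i) ins
    instrF-intro {q} {i} e i< f s = go s (stepF-intro e i<) f
      where
      -- The next location and registers are generalised to variables so that the step can be
      -- matched on.
      go : ∀ {l rs′ ins} → Step D (locAt h i) (regsAt h i) l rs′ →
           (∀ {m} → (∀ s → Moves (m s) (regsAt h i s) (rs′ s)) → K ▸ q ⊨ stepF l m) →
           fetch D (locAt h i) ≡ just ins → K ▸ q ⊨ instrF (locAt h i) ins
      go (inc g p) st f with refl ← trans (sym g) f = st (only-moves up p)
      go (jz {r} g z p) st f with refl ← trans (sym g) f = ∧-intro
        (⇒-intro λ _ → st (keep-moves p))
        (⇒-intro λ n → ⊥-elim (neg-elim n (AX-intro λ u e₁ → ⇒-intro λ a →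
          end-intro (trans (value-of e e₁ a) (cong (value r) z)))))
      go (dec {r} {m = m} g z p) st f with refl ← trans (sym g) f = ∧-intro
        (⇒-intro λ a → ⊥-elim (let (u , e₁ , e₂) = value-node e (register-< D f) in
          ⇒-elim (AX-elim a e₁) (reg-intro e₂) (end-elim (trans e₂ (cong (value r) z)))))
        (⇒-intro λ _ → st (only-moves (subst (λ k → Moves down k m) (sym z) down) p))

    programF-intro : ∀ {q} P o →
      (∀ {k ins} → fetch P k ≡ just ins → K ▸ q ⊨ (mark (loc (o + k)) ⇒ᶠ instrF (o + k) ins)) →
      K ▸ q ⊨ programF o P
    programF-intro []      o f = tt-intro
    programF-intro {q} (i ∷ P) o f = ∧-intro
      (subst (λ l → K ▸ q ⊨ (mark (loc l) ⇒ᶠ instrF l i)) (+-identityʳ o) (f {0} refl))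
      (programF-intro P (suc o) λ {k} {ins} e →
        subst (λ l → K ▸ q ⊨ (mark (loc l) ⇒ᶠ instrF l ins)) (+-suc o k) (f {suc k} e))

    ruleF-intro : ∀ {q l ins} → fetch D l ≡ just ins → K ▸ q ⊨ (mark (loc l) ⇒ᶠ instrF l ins)
    ruleF-intro {q} {l} {ins} f = ⇒-intro λ a → let (i , e , l≡) = loc-view a in
      go i e (at i l≡) (status h i)
      where
      at : ∀ i → l ≡ locAt h i ⊓ length D → l ≡ locAt h i
      at i e with ≤-total (locAt h i) (length D)
      ... | inj₁ le = trans e (m≤n⇒m⊓n≡m le)
      -- Here the cap would give `l` the value `length D`, but `l` holds an instruction.
      ... | inj₂ ge = contradiction (trans e (m≥n⇒m⊓n≡n ge)) (<⇒≢ (fetch-< D f))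

      go : ∀ i → view q ≡ moment i → l ≡ locAt h i → Status h i → K ▸ q ⊨ instrF l ins
      go i e refl (halted g _)   with () ← trans (sym g) f
      go i e refl (running i< s) = instrF-intro e i< f s

    bodyF-intro : out ≢ 1 → ∀ {q} → view q ≡ moment 0 → K ▸ q ⊨ bodyF x
    bodyF-intro out≢1 {q} e = ∧-intro
      (∧-intro (marked⇒⊨ time (cong (λ N → marked N time) e))
      (∧-intro (marked⇒⊨ (loc 0) (cong (λ N → marked N (loc 0)) e))
      (∧-intro (conj-intro (width D) λ s _ → zeros s)
               (AG-intro λ q′ → ∧-intro (aliveF-intro q′) (∧-intro (haltF-intro out≢1 q′)
                 (programF-intro D 0 ruleF-intro))))))
      (AX-intro λ u e₁ → ⇒-intro λ a → num-intro x (value-of e e₁ a))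
      where
      zeros : ∀ s → K ▸ q ⊨ (if s ≡ᵇ 0 then tt else isZeroF s)
      zeros zero    = tt-intro
      zeros (suc s) = AX-intro λ u e₁ → ⇒-intro λ a → end-intro (value-of e e₁ a)

-- Diagonalisation

∧-CTL : ∀ {φ ψ} → IsCTL φ → IsCTL ψ → IsCTL (φ ∧ᶠ ψ)
∧-CTL a b = neg (or (neg a) (neg b))

⇒-CTL : ∀ {φ ψ} → IsCTL φ → IsCTL ψ → IsCTL (φ ⇒ᶠ ψ)
⇒-CTL a b = neg (neg (or (neg a) b))

tt-CTL : IsCTL tt
tt-CTL = neg (neg (or (var 0) (neg (var 0))))

conj-CTL : ∀ n {f} → (∀ r → IsCTL (f r)) → IsCTL (conj n f)
conj-CTL zero    c = tt-CTL
conj-CTL (suc n) c = ∧-CTL (conj-CTL n c) (c n)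

num-CTL : ∀ m → IsCTL (num m)
num-CTL zero    = var _
num-CTL (suc m) = neg (or (var _) (neg (AX (num-CTL m))))

pre-CTL : ∀ m → IsCTL (pre m)
pre-CTL keep = var 0
pre-CTL up   = var 0
pre-CTL down = EX (var 0)

post-CTL : ∀ m → IsCTL (post m)
post-CTL keep = var 0
post-CTL up   = ∧-CTL (neg (var _)) (AX (var 0))
post-CTL down = var 0

module _ {D : Program} where
  open Simulation D

  stepF-CTL : ∀ l m → IsCTL (stepF l m)
  stepF-CTL l m = ∧-CTL (AX (⇒-CTL (var _) (var _))) (conj-CTL (width D) λ s →
    ⇒-CTL (EX (∧-CTL (var _) (pre-CTL (m s)))) (AX (⇒-CTL (var _) (AX (⇒-CTL (var _) (post-CTL (m s)))))))

  isZeroF-CTL : ∀ r → IsCTL (isZeroF r)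
  isZeroF-CTL r = AX (⇒-CTL (var _) (var _))

  instrF-CTL : ∀ l i → IsCTL (instrF l i)
  instrF-CTL l (inc r)      = stepF-CTL _ _
  instrF-CTL l (decjz r l′) =
    ∧-CTL (⇒-CTL (isZeroF-CTL r) (stepF-CTL l′ (λ _ → keep)))
          (⇒-CTL (neg (isZeroF-CTL r)) (stepF-CTL _ _))

  programF-CTL : ∀ o P → IsCTL (programF o P)
  programF-CTL o []      = tt-CTL
  programF-CTL o (i ∷ P) = ∧-CTL (⇒-CTL (var _) (instrF-CTL o i)) (programF-CTL (suc o) P)

  nodeF-CTL : IsCTL nodeF
  nodeF-CTL = ∧-CTL (⇒-CTL (var _) (∧-CTL (EX (var _)) (conj-CTL (width D) λ _ → EX (var _))))
    (∧-CTL (⇒-CTL (var _) (AX (⇒-CTL (var _) (neg (num-CTL 1))))) (programF-CTL 0 D))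

  bodyF-CTL : ∀ x → IsCTL (bodyF x)
  bodyF-CTL x = ∧-CTL
    (∧-CTL (var _) (∧-CTL (var _) (∧-CTL (conj-CTL (width D) zeros) (neg (EU tt-CTL (neg nodeF-CTL))))))
    (AX (⇒-CTL (var _) (num-CTL x)))
    where
    zeros : ∀ s → IsCTL (if s ≡ᵇ 0 then tt else isZeroF s)
    zeros zero    = tt-CTL
    zeros (suc s) = isZeroF-CTL (suc s)

-- Contexts whose hole sits in the last argument throughout: their codes act
-- on the code of the formula in the hole by pairing with constants on the left.
record Context : Set where
  field
    plug   : Form → Form
    code   : List ℕ
    encode-plug : ∀ φ → encode (plug φ) ≡ pairs code (encode φ)
open Context

infixr 9 _∘ᶜ_

_∘ᶜ_ : Context → Context → Context
plug (c ∘ᶜ d) = plug c ∘ plug d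
code (c ∘ᶜ d) = code c ++ code d
encode-plug (c ∘ᶜ d) φ = begin
  encode (plug c (plug d φ))           ≡⟨ encode-plug c _ ⟩
  pairs (code c) (encode (plug d φ))   ≡⟨ cong (pairs (code c)) (encode-plug d φ) ⟩
  pairs (code c) (pairs (code d) (encode φ)) ≡⟨ foldr-++ pair (encode φ) (code c) (code d) ⟨
  pairs (code c ++ code d) (encode φ)  ∎
  where open ≡-Reasoning

idᶜ negᶜ AXᶜ : Context
idᶜ  = record { plug = λ φ → φ ; code = []     ; encode-plug = λ _ → refl }
negᶜ = record { plug = neg     ; code = 1 ∷ [] ; encode-plug = λ _ → refl }
AXᶜ  = record { plug = AX      ; code = 6 ∷ [] ; encode-plug = λ _ → refl }

orᶜ : Form → Context
orᶜ φ = record { plug = or φ ; code = 2 ∷ encode φ ∷ [] ; encode-plug = λ _ → refl }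

exᶜ allᶜ : AP → Context
exᶜ p  = record { plug = exQ p ; code = 7 ∷ p ∷ [] ; encode-plug = λ _ → refl }
allᶜ p = negᶜ ∘ᶜ exᶜ p ∘ᶜ negᶜ

-- Alternating prefixes of dummy quantifiers

dummyE dummyA : ℕ → Context
dummyE zero    = idᶜ
dummyE (suc k) = exᶜ 1 ∘ᶜ dummyA k
dummyA zero    = idᶜ
dummyA (suc k) = allᶜ 1 ∘ᶜ dummyE k

dummyE-EQ : ∀ k {φ} → IsCTL φ → EQ (suc k) (plug (dummyE (suc k)) φ)
dummyA-AQ : ∀ k {φ} → IsCTL φ → AQ (suc k) (plug (dummyA (suc k)) φ)
dummyE-EQ zero    c = base 1 c
dummyE-EQ (suc k) c = eA 1 (dummyA-AQ k c)
dummyA-AQ zero    c = base 1 c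
dummyA-AQ (suc k) c = aE 1 (dummyE-EQ k c)

Dummy : ∀ {n} → Kripke n → (Fin n → AP → Bool) → Set
Dummy K L = SameMarks L (lab K) × (∀ q → L q 0 ≡ lab K q 0)

-- All these quantifiers bind atom 1, so the marks and atom 0 survive; universal ones are
-- instantiated by the constant `true`. As these are written with negations, the result holds up to
-- double negation.
dummyE-elim : ∀ k {n} (K : Kripke n) {q φ} → sat K q (plug (dummyE k) φ) →
              (∀ L → Dummy K L → sat (K ⟨ L ⟩) q φ → ⊥) → ⊥
dummyA-elim : ∀ k {n} (K : Kripke n) {q φ} → sat K q (plug (dummyA k) φ) →
              (∀ L → Dummy K L → sat (K ⟨ L ⟩) q φ → ⊥) → ⊥
dummyE-elim zero    K s       k = k (lab K) ((λ _ _ → refl) , λ _ → refl) s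
dummyE-elim (suc j) K (v , s) k = dummyA-elim j (relabel K 1 v) s k
dummyA-elim zero    K s       k = k (lab K) ((λ _ _ → refl) , λ _ → refl) s
dummyA-elim (suc j) K s       k = s ((λ _ → true) , λ s′ → dummyE-elim j (relabel K 1 _) s′ k)

dummyE-intro : ∀ k {n} (K : Kripke n) {q φ} → (∀ L → SameMarks L (lab K) → sat (K ⟨ L ⟩) q φ) →
               sat K q (plug (dummyE k) φ)
dummyA-intro : ∀ k {n} (K : Kripke n) {q φ} → (∀ L → SameMarks L (lab K) → sat (K ⟨ L ⟩) q φ) →
               sat K q (plug (dummyA k) φ)
dummyE-intro zero    K f = f (lab K) λ _ _ → refl
dummyE-intro (suc j) K f = (λ _ → true) , dummyA-intro j (relabel K 1 _) f
dummyA-intro zero    K f = f (lab K) λ _ _ → refl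
dummyA-intro (suc j) K f (v , s) = s (dummyE-intro j (relabel K 1 v) f)

-- The universal quantifier over atom 0 does the work. Dummies below it raise the alternation depth,
-- and a dummy existential in front leads to the other hierarchy.
prefixA prefixE : ℕ → Context
prefixA k = allᶜ 0 ∘ᶜ dummyE k
prefixE k = exᶜ 1 ∘ᶜ prefixA k

prefixA-AQ : ∀ k {φ} → IsCTL φ → AQ (suc k) (plug (prefixA k) φ)
prefixA-AQ zero    c = base 0 c
prefixA-AQ (suc k) c = aE 0 (dummyE-EQ k c)

prefixA-elim : ∀ k {n} (K : Kripke n) {q φ} → sat K q (plug (prefixA k) φ) → Always K q φ
prefixA-elim k K s v f = s (v , λ s′ → dummyE-elim k (relabel K 0 v) s′ λ L (m , p) a →
  f L (record { marks = m ; props = p }) ⟪ a ⟫)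

prefixA-intro : ∀ k {n} (K : Kripke n) {q φ} → (∀ L → SameMarks L (lab K) → sat (K ⟨ L ⟩) q φ) →
                sat K q (plug (prefixA k) φ)
prefixA-intro k K f (v , s) = s (dummyE-intro k (relabel K 0 v) f)

-- The interface through which one argument serves both hierarchies.
record UniversalPrefix (F : Form → Set) (Q : Context) : Set where
  field
    member : ∀ {φ} → IsCTL φ → F (plug Q φ)
    elim   : ∀ {φ} → Satisfiable (plug Q φ) →
             Σ ℕ λ n → Σ (Kripke n) λ K → Σ (Fin n) λ q → Always K q φ
    intro  : ∀ {φ n} (K : Kripke n) q → (∀ L → SameMarks L (lab K) → (K ⟨ L ⟩) ▸ q ⊨ φ) →
             Satisfiable (plug Q φ)

prefixA-universal : ∀ k → UniversalPrefix (AQ (suc k)) (prefixA k)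
prefixA-universal k = record
  { member = prefixA-AQ k
  ; elim   = λ (n , K , q , s) → n , K , q , prefixA-elim k K s
  ; intro  = λ K q f → _ , K , q , prefixA-intro k K λ L m → holds (f L m) }

prefixE-universal : ∀ k → UniversalPrefix (EQ (suc (suc k))) (prefixE k)
prefixE-universal k = record
  { member = λ c → eA 1 (prefixA-AQ k c)
  ; elim   = λ (n , K , q , v , s) → n , relabel K 1 v , q , prefixA-elim k (relabel K 1 v) s
  ; intro  = λ K q f → _ , K , q , (λ _ → true) , prefixA-intro k (relabel K 1 _) λ L m → holds (f L m) }

-- The code of the diagonal formula and the contradiction

numᶜ inputᶜ : Context
numᶜ   = negᶜ ∘ᶜ orᶜ (mark end) ∘ᶜ negᶜ ∘ᶜ AXᶜ
inputᶜ = negᶜ ∘ᶜ AXᶜ ∘ᶜ negᶜ ∘ᶜ negᶜ ∘ᶜ orᶜ (neg (mark (reg 0)))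

encode-plug-≡ : ∀ (c : Context) {φ ψ} → ψ ≡ plug c φ → encode ψ ≡ pairs (code c) (encode φ)
encode-plug-≡ c refl = encode-plug c _

encode-num : ∀ m → encode (num m) ≡ repeat (pairs (code numᶜ)) m (encode (mark end))
encode-num = repeat-unique (pairs (code numᶜ)) (λ m → encode (num m))
  (λ m → encode-plug-≡ numᶜ {num m} {num (suc m)} refl)

-- The machine enters only through the code `x` of `χ`; all else is pairing with constants, which a
-- counter machine can carry out.
encode-diagonal : ∀ Q χ x → encode χ ≡ x →
  encode (plug Q (neg (or χ (neg (inputF x))))) ≡
  selfCode (encode (mark end)) (code numᶜ) (code inputᶜ) (code (Q ∘ᶜ negᶜ) ++ 2 ∷ []) x
encode-diagonal Q χ x χ≡ = begin
  encode (plug Q (neg (or χ ι)))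
    ≡⟨ encode-plug (Q ∘ᶜ negᶜ) (or χ ι) ⟩
  pairs cs (encode (or χ ι))
    -- The tag 2 of `or` joins the constants, leaving the pair of the codes of the two disjuncts.
    ≡⟨ foldr-++ pair (pair (encode χ) (encode ι)) cs (2 ∷ []) ⟨
  body (encode χ) (encode ι)
    ≡⟨ cong₂ body {encode χ} {x} {encode ι} {pairs (code inputᶜ) (encode (num x))}
         χ≡ (encode-plug-≡ inputᶜ {num x} {ι} refl) ⟩
  body x (pairs (code inputᶜ) (encode (num x)))
    ≡⟨ cong (λ y → body x (pairs (code inputᶜ) y))
         {encode (num x)} {repeat (pairs (code numᶜ)) x (encode (mark end))} (encode-num x) ⟩
  selfCode (encode (mark end)) (code numᶜ) (code inputᶜ) (cs ++ 2 ∷ []) x ∎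
  where
  open ≡-Reasoning
  ι  = neg (inputF x)
  cs = code (Q ∘ᶜ negᶜ)
  body : ℕ → ℕ → ℕ
  body y z = pairs (cs ++ 2 ∷ []) (pair y z)

-- The constants of the contexts are kept as variables: comparing closed
-- codes up to conversion would unfold them into unary numerals.
module _ {F Q} (U : UniversalPrefix F Q) (base : ℕ) (cs₁ cs₂ cs₃ : List ℕ)
         (diagonal : ∀ χ x → encode χ ≡ x →
                     encode (plug Q (neg (or χ (neg (inputF x))))) ≡ selfCode base cs₁ cs₂ cs₃ x) where
  open UniversalPrefix U

  -- The answer of `M` on `ψ` is the output of `D` on `x`. The answer 1 claims a model, which would
  -- have to follow a run that `haltF` forbids; any other answer denies one, although the halting
  -- run provides it.
  refutation : ∀ {M} D x → encode (neg (Simulation.initF D)) ≡ x →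
    (∀ {out} → Halts M 0 (initRegs (selfCode base cs₁ cs₂ cs₃ x)) out → Halts D 0 (initRegs x) out) →
    ¬ DecidesSat F M
  refutation {M} D x x≡ run-D decides =
    let (out , r , iff) = decides ψ (member (bodyF-CTL x)) in refute r iff (out ≟ 1)
    where
    open Simulation D
    ψ = plug Q (bodyF x)

    ψ-code : encode ψ ≡ selfCode base cs₁ cs₂ cs₃ x
    ψ-code = diagonal (neg initF) x x≡

    halts : ∀ {out} → HaltsWith M (encode ψ) out → Halts D 0 (initRegs x) out
    halts {out} (fuel , r) = run-D
      (run⇒Halts fuel M 0 (initRegs (selfCode base cs₁ cs₂ cs₃ x))
        (subst (λ c → run fuel M 0 (initRegs c) ≡ just out) ψ-code r))

    refute : ∀ {out} → HaltsWith M (encode ψ) out → (out ≡ 1 ⇔ Satisfiable ψ) → Dec (out ≡ 1) → ⊥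
    refute r iff (yes refl) =
      let (n , K , q , a) = elim {bodyF x} (Equivalence.to iff refl)
          open Soundness D K
      in initial a (simulate (halts r))
    refute r iff (no out≢1) = out≢1 (Equivalence.from iff
      (intro {bodyF x} model (proj₁ start) λ L L≈ → bodyF-intro L≈ out≢1 (proj₂ start)))
      where
      open Model D (halts r)
      start = view-surjective (moment 0) z≤n

  self-refutation : ∀ M → ¬ DecidesSat F M
  -- The code is passed as a variable with an equation, so that its unary value is not computed.
  self-refutation M = at-code _ refl
    where
    at-code : ∀ x → encode (neg (Simulation.initF (precompose base cs₁ cs₂ cs₃ M))) ≡ x →
              ¬ DecidesSat F M
    at-code x x≡ = refutation {M} (precompose base cs₁ cs₂ cs₃ M) x x≡
      (Halts-precompose base cs₁ cs₂ cs₃ {M} x)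

undecidable : ∀ {F Q} → UniversalPrefix F Q → SatUndecidable F
undecidable {Q = Q} U (M , decides) = self-refutation U
  (encode (mark end)) (code numᶜ) (code inputᶜ) (code (Q ∘ᶜ negᶜ) ++ 2 ∷ [])
  (encode-diagonal Q) M decides

theorem5p2 : ((k : ℕ) → 1 ≤ k → SatUndecidable (AQ k))
    × ((k : ℕ) → 2 ≤ k → SatUndecidable (EQ k))
theorem5p2 = (λ { (suc k) _ → undecidable (prefixA-universal k) })
           , (λ { (suc (suc k)) _ → undecidable (prefixE-universal k) ; (suc zero) (s≤s ()) })
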